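{- Let $N\ge 5$ be an integer, and write $N=3k+i$ with $k\in\mathbb{N}$ and $i\in\{0,1,2\}$. Let $SP^N_*$ denote the maximal number of finite paths ending in the sink, over all connected acyclic directed graphs with exactly $N$ edges and exactly one sink. Then $$SP^N_*=\begin{cases}\frac12\left(11\cdot 3^{k-1}-1\right) & \text{if } i=0,\\[2pt] \frac12\left(47\cdot 3^{k-2}-1\right) & \text{if } i=1,\\[2pt] \frac12\left(23\cdot 3^{k-1}-1\right) & \text{if } i=2.\end{cases}$$
   Context: A directed graph $E=(E^0,E^1,s_E,t_E)$ consists of a set of vertices $E^0$, a set of edges $E^1$, and source and target maps $s_E,t_E\colon E^1\to E^0$ (multiple edges are allowed). A finite path of length $n\ge1$ is a tuple $(e_1,\dots,e_n)$ of edges with $t_E(e_i)=s_E(e_{i+1})$ for $1\le i<n$; it ends at $t_E(e_n)$. Vertices are paths of length $0$, ending at themselves. $E$ is acyclic if it has no path of positive length whose beginning and end coincide; $E$ is connected if any two vertices are joined by a finite undirected path. A sink is a vertex emitting no edges. -}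

module Defs where

open import Data.Fin.Base using (Fin; zero; suc)
open import Data.Nat.Base using (ℕ; _*_; _∸_; _^_; _/_; _≤_)
open import Data.Product using (Σ-syntax; ∃-syntax; ∃!; _×_; proj₁)
open import Function.Bundles using (_↔_; _↣_)
open import Relation.Binary.Construct.Closure.Equivalence using (EqClosure)
open import Relation.Binary.Construct.Closure.ReflexiveTransitive using (Star)
open import Relation.Binary.Construct.Closure.Transitive using (TransClosure)
open import Relation.Binary.PropositionalEquality.Core using (_≡_)
open import Relation.Nullary.Negation.Core using (¬_)

record Digraph : Set₁ where
  field
    E⁰ : Set
    E¹ : Set
    s  : E¹ → E⁰
    t  : E¹ → E⁰

  Edge : E⁰ → E⁰ → Set
  Edge u v = Σ[ e ∈ E¹ ] (s e ≡ u × t e ≡ v)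

  -- A list of composable edges from u to v; `ε : Path v v` is the vertex v
  -- regarded as a path of length 0.  Parallel edges give different paths.
  Path : E⁰ → E⁰ → Set
  Path = Star Edge

  PathsEndingAt : E⁰ → Set
  PathsEndingAt v = ∃[ u ] Path u v

  -- `TransClosure Edge v v` is the type of paths of length ≥ 1 from v to v.
  Acyclic : Set
  Acyclic = ∀ v → ¬ TransClosure Edge v v

  Connected : Set
  Connected = ∀ u v → EqClosure Edge u v

  IsSink : E⁰ → Set
  IsSink v = ∀ e → ¬ (s e ≡ v)

record Admissible (N : ℕ) (G : Digraph) : Set where
  open Digraph G
  field
    edges      : Fin N ↔ E¹
    connected  : Connected
    acyclic    : Acyclic
    uniqueSink : ∃! _≡_ IsSink

  PathsToSink : Set
  PathsToSink = PathsEndingAt (proj₁ uniqueSink)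

HasExactly : ℕ → Set → Set
HasExactly m A = Fin m ↔ A

-- If A has m distinct elements then m ≤ n.  This bounds A without
-- presupposing that A has been enumerated, so it rules out infinite A as well.
HasAtMost : ℕ → Set → Set
HasAtMost n A = ∀ m → Fin m ↣ A → m ≤ n

-- `IsSP N n`: n is the maximum SP^N_*, i.e. it is attained and is an upper bound.
record IsSP (N n : ℕ) : Set₁ where
  field
    attained   : Σ[ G ∈ Digraph ] Σ[ A ∈ Admissible N G ]
                   HasExactly n (Admissible.PathsToSink A)
    upperBound : ∀ (G : Digraph) (A : Admissible N G) →
                   HasAtMost n (Admissible.PathsToSink A)

-- The value for N = 3k + i.  When N ≥ 5 we have k ≥ 1, and k ≥ 2 if i = 1, so
-- the subtractions in the exponents are exact; the numerators are positive and
-- even, so `∸ 1` and `/ 2` are exact too.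
closedForm : (k : ℕ) (i : Fin 3) → ℕ
closedForm k zero             = (11 * 3 ^ (k ∸ 1) ∸ 1) / 2
closedForm k (suc zero)       = (47 * 3 ^ (k ∸ 2) ∸ 1) / 2
closedForm k (suc (suc zero)) = (23 * 3 ^ (k ∸ 1) ∸ 1) / 2

{-# OPTIONS --safe #-}

-- Attaching a new sink to the old one by d parallel edges turns n paths into
-- 1 + d * n, and iterating this with suitable d attains the maximum.  For the
-- upper bound, peel off the vertices one at a time, starting next to the sink:
-- a vertex with d outgoing edges, all leading to vertices that start at most B
-- paths, starts at most d * B paths.  So if `gain r` bounds the number of paths
-- per unit of B that begin with one of the r remaining edges, all that is needed
-- is d * (1 + gain r) ≤ gain (d + r).
module Submission where

open import Defs
open import Data.Empty using (⊥)
open import Data.Fin.Base using (Fin; toℕ)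
  renaming (zero to fzero; suc to fsuc)
open import Data.Fin.Induction using (spo-wellFounded)
open import Data.Fin.Properties using (0↔⊥; 1↔⊤; +↔⊎; *↔×; injective⇒≤)
open import Data.List.Base
  using (List; []; _∷_; [_]; _++_; map; length; lookup; filter; allFin; cartesianProduct)
open import Data.List.Membership.Propositional using (_∈_; find; lose)
open import Data.List.Membership.Propositional.Properties
  using (∈-map⁺; ∈-++⁺ˡ; ∈-++⁺ʳ; ∈-filter⁺; ∈-filter⁻; ∈-allFin; ∈-cartesianProduct⁺)
open import Data.List.Properties
  using (length-++; length-map; length-tabulate; filter-some)
import Data.List.Relation.Unary.All as All
open import Data.List.Relation.Unary.Any as Any using (Any; here; there; any?)
open import Data.List.Relation.Unary.Any.Properties using (lookup-index)
open import Data.Maybe.Base using (Maybe; just; nothing)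
open import Data.Nat.Base
open import Data.Nat.DivMod using (m*n/n≡m)
open import Data.Nat.Properties hiding (_≟_)
open import Data.Nat.Tactic.RingSolver using (solve-∀)
open import Data.Product.Base
  using (Σ-syntax; ∃-syntax; _×_; _,_; proj₁; proj₂; map₂)
open import Data.Product.Function.NonDependent.Propositional using (_×-↔_)
open import Data.Sum.Base using (_⊎_; inj₁; inj₂)
open import Data.Sum.Function.Propositional using (_⊎-↔_)
open import Data.Unit.Base using (⊤; tt)
open import Function.Base using (id; _∘_; flip)
open import Function.Bundles using (_↔_; mk↔ₛ′; Inverse; Injection)
open import Function.Construct.Identity using (↔-id)
open import Function.Properties.Inverse using (↔-trans)
open import Induction.WellFounded using (Acc; acc; WellFounded)
open import Relation.Binary.Construct.Closure.Equivalence as Eq using (EqClosure)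
open import Relation.Binary.Construct.Closure.ReflexiveTransitive using (ε; _◅_; _◅◅_)
open import Relation.Binary.Construct.Closure.Symmetric using (fwd; bwd)
open import Relation.Binary.Construct.Closure.Transitive as Trans
  using (TransClosure; _∷_)
open import Relation.Binary.Definitions using (DecidableEquality)
open import Relation.Binary.PropositionalEquality hiding ([_])
open import Relation.Nullary.Decidable
  using (Dec; yes; no; True; toWitness; ¬?; _×-dec_; decidable-stable; ¬¬-excluded-middle)
open import Relation.Nullary.Negation using (¬_; contradiction; ¬¬-map; ¬¬-Monad)

-- Superlinearity and closed form of `gain`.

-- suc (gain n) is SP^n_*, also for the n < 5 to which the closed form does not apply.
gain : ℕ → ℕ
gain 0 = 0
gain 1 = 1
gain 2 = 2
gain 3 = 4
gain 4 = 6
gain 5 = 10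
gain 6 = 15
gain 7 = 22
gain (suc (suc (suc n@(suc (suc (suc (suc (suc _)))))))) = 3 * suc (gain n)

≤-by-evaluation : ∀ {m n} {_ : True (m ≤? n)} → m ≤ n
≤-by-evaluation {_} {_} {m≤n} = toWitness m≤n

-- From r = 8 on, `gain r` and `gain (1 + r)` both arise from the values three steps earlier by x ↦
-- 3 * (1 + x), which keeps the inequality with 2 to spare. So the induction has step three, and r ≤
-- 7 is evaluated.
gain-1 : ∀ r → 1 * suc (gain r) ≤ gain (1 + r)
gain-1 0 = ≤-by-evaluation
gain-1 1 = ≤-by-evaluation
gain-1 2 = ≤-by-evaluation
gain-1 3 = ≤-by-evaluation
gain-1 4 = ≤-by-evaluation
gain-1 5 = ≤-by-evaluation
gain-1 6 = ≤-by-evaluation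
gain-1 7 = ≤-by-evaluation
gain-1 (suc (suc (suc n@(suc (suc (suc (suc (suc _)))))))) = begin
  1 * suc (3 * suc (gain n))    ≤⟨ m≤n+m _ 2 ⟩
  2 + 1 * suc (3 * suc (gain n)) ≡⟨ lem (gain n) ⟩
  3 * suc (1 * suc (gain n))    ≤⟨ *-monoʳ-≤ 3 (s≤s (gain-1 n)) ⟩
  3 * suc (gain (1 + n))        ∎
  where
  open ≤-Reasoning
  lem : ∀ x → 2 + 1 * suc (3 * suc x) ≡ 3 * suc (1 * suc x)
  lem = solve-∀

gain-2 : ∀ r → 2 * suc (gain r) ≤ gain (2 + r)
gain-2 0 = ≤-by-evaluation
gain-2 1 = ≤-by-evaluation
gain-2 2 = ≤-by-evaluation
gain-2 3 = ≤-by-evaluation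
gain-2 4 = ≤-by-evaluation
gain-2 5 = ≤-by-evaluation
gain-2 6 = ≤-by-evaluation
gain-2 7 = ≤-by-evaluation
gain-2 (suc (suc (suc n@(suc (suc (suc (suc (suc _)))))))) = begin
  2 * suc (3 * suc (gain n))    ≤⟨ m≤n+m _ 1 ⟩
  1 + 2 * suc (3 * suc (gain n)) ≡⟨ lem (gain n) ⟩
  3 * suc (2 * suc (gain n))    ≤⟨ *-monoʳ-≤ 3 (s≤s (gain-2 n)) ⟩
  3 * suc (gain (2 + n))        ∎
  where
  open ≤-Reasoning
  lem : ∀ x → 1 + 2 * suc (3 * suc x) ≡ 3 * suc (2 * suc x)
  lem = solve-∀

-- For r ≥ 5 this is the recursive clause of `gain`, with equality.
gain-3 : ∀ r → 3 * suc (gain r) ≤ gain (3 + r)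
gain-3 0 = ≤-by-evaluation
gain-3 1 = ≤-by-evaluation
gain-3 2 = ≤-by-evaluation
gain-3 3 = ≤-by-evaluation
gain-3 4 = ≤-by-evaluation
gain-3 (suc (suc (suc (suc (suc _))))) = ≤-refl

-- A vertex with d + 2 ≥ 4 edges does no better than two successive vertices with d and 2 edges,
-- because d + 2 ≤ 2 * d.
gain-superlinear : ∀ d r → d * suc (gain r) ≤ gain (d + r)
gain-superlinear 0 r = z≤n
gain-superlinear 1 r = gain-1 r
gain-superlinear 2 r = gain-2 r
gain-superlinear 3 r = gain-3 r
gain-superlinear (suc (suc d@(suc (suc d′)))) r = begin
  (2 + d) * x                  ≤⟨ m≤m+n _ (2 + d′ * x) ⟩
  (2 + d) * x + (2 + d′ * x)   ≡⟨ lem d′ x ⟩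
  2 * suc (d * x)              ≤⟨ *-monoʳ-≤ 2 (s≤s (gain-superlinear d r)) ⟩
  2 * suc (gain (d + r))       ≤⟨ gain-2 (d + r) ⟩
  gain (2 + (d + r))           ∎
  where
  open ≤-Reasoning
  x = suc (gain r)
  lem : ∀ d′ x → (4 + d′) * x + (2 + d′ * x) ≡ 2 * suc ((2 + d′) * x)
  lem = solve-∀

-- With P = `suc (gain (5 + n))`, three more edges turn P into 1 + 3 * P, so 2 * P + 1 is exactly
-- tripled.
gain-step : ∀ c j n → c * 3 ^ j ≡ suc (suc (gain (5 + n)) * 2) →
            c * 3 ^ suc j ≡ suc (suc (gain (8 + n)) * 2)
gain-step c j n eq = begin
  c * (3 * 3 ^ j)                    ≡⟨ lem c (3 ^ j) ⟩
  3 * (c * 3 ^ j)                    ≡⟨ cong (3 *_) eq ⟩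
  3 * suc (suc (gain (5 + n)) * 2)   ≡⟨ lem′ (gain (5 + n)) ⟩
  suc (suc (gain (8 + n)) * 2)       ∎
  where
  open ≡-Reasoning
  lem : ∀ c x → c * (3 * x) ≡ 3 * (c * x)
  lem = solve-∀
  lem′ : ∀ x → 3 * suc (suc x * 2) ≡ suc (suc (3 * suc x) * 2)
  lem′ = solve-∀

gain-closed : ∀ c n₀ → c * 1 ≡ suc (suc (gain (5 + n₀)) * 2) →
              ∀ j → c * 3 ^ j ≡ suc (suc (gain (5 + (j * 3 + n₀))) * 2)
gain-closed c n₀ eq zero    = eq
gain-closed c n₀ eq (suc j) = gain-step c j (j * 3 + n₀) (gain-closed c n₀ eq j)

half-gain : ∀ c n₀ → c * 1 ≡ suc (suc (gain (5 + n₀)) * 2) →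
            ∀ j {x N} → x ≡ c * 3 ^ j → 5 + (j * 3 + n₀) ≡ N →
            (x ∸ 1) / 2 ≡ suc (gain N)
half-gain c n₀ eq j refl refl =
  trans (cong (λ x → (x ∸ 1) / 2) (gain-closed c n₀ eq j))
        (m*n/n≡m (suc (gain (5 + (j * 3 + n₀)))) 2)

closedForm-gain : ∀ k i → 5 ≤ 3 * k + toℕ i → closedForm k i ≡ suc (gain (3 * k + toℕ i))
closedForm-gain zero fzero ()
closedForm-gain zero (fsuc fzero) (s≤s ())
closedForm-gain zero (fsuc (fsuc fzero)) (s≤s (s≤s ()))
closedForm-gain (suc zero) fzero (s≤s (s≤s (s≤s ())))
closedForm-gain (suc (suc j)) fzero _ =
  -- This residue class starts at N = 6, with constant 2 * 16 + 1 = 33 = 11 * 3; the other two start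
  -- at N = 7 and N = 5, with 47 and 23.
  half-gain 33 1 refl j (sym (*-assoc 11 3 (3 ^ j))) (lem j)
  where
  lem : ∀ j → 5 + (j * 3 + 1) ≡ 3 * (2 + j) + 0
  lem = solve-∀
closedForm-gain (suc zero) (fsuc fzero) (s≤s (s≤s (s≤s (s≤s ()))))
closedForm-gain (suc (suc j)) (fsuc fzero) _ = half-gain 47 2 refl j refl (lem j)
  where
  lem : ∀ j → 5 + (j * 3 + 2) ≡ 3 * (2 + j) + 1
  lem = solve-∀
closedForm-gain (suc j) (fsuc (fsuc fzero)) _ = half-gain 23 0 refl j refl (lem j)
  where
  lem : ∀ j → 5 + (j * 3 + 0) ≡ 3 * (1 + j) + 2
  lem = solve-∀

-- Lower bound: graphs attaining the maximum.

Attains : ℕ → ℕ → Set₁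
Attains N n = Σ[ G ∈ Digraph ] Σ[ A ∈ Admissible N G ] HasExactly n (Admissible.PathsToSink A)

point : Digraph
point = record { E⁰ = ⊤ ; E¹ = ⊥ ; s = λ () ; t = λ () }

point-attains : Attains 0 1
point-attains = point , admissible , ↔-trans 1↔⊤ paths
  where
  open Digraph point
  admissible : Admissible 0 point
  admissible = record
    { edges      = 0↔⊥
    ; connected  = λ _ _ → ε
    ; acyclic    = λ { _ Trans.[ () , _ ] ; _ ((() , _) ∷ _) }
    ; uniqueSink = tt , (λ ()) , λ _ → refl
    }
  paths : ⊤ ↔ PathsEndingAt tt
  paths = mk↔ₛ′ (λ _ → tt , ε) _ (λ { (tt , ε) → refl ; (_ , (() , _) ◅ _) }) (λ _ → refl)

module AttachSink (G : Digraph) (σ : Digraph.E⁰ G) (d : ℕ) where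
  private module G = Digraph G

  attached : Digraph
  attached = record
    { E⁰ = Maybe G.E⁰
    ; E¹ = Fin d ⊎ G.E¹
    ; s  = λ { (inj₁ _) → just σ  ; (inj₂ e) → just (G.s e) }
    ; t  = λ { (inj₁ _) → nothing ; (inj₂ e) → just (G.t e) }
    }

  open Digraph attached

  no-edge-from-new : ∀ {v} → ¬ Edge nothing v
  no-edge-from-new (inj₁ _ , () , _)
  no-edge-from-new (inj₂ _ , () , _)

  lift-edge : ∀ {u v} → G.Edge u v → Edge (just u) (just v)
  lift-edge (e , refl , refl) = inj₂ e , refl , refl

  no-walk-from-new : ∀ {v} → ¬ TransClosure Edge nothing v
  no-walk-from-new Trans.[ e ] = no-edge-from-new e
  no-walk-from-new (e ∷ _)     = no-edge-from-new e

  -- A walk that enters the new sink cannot leave it, so a walk between old vertices uses old edges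
  -- only.
  restrict : ∀ {u v} → TransClosure Edge (just u) (just v) → TransClosure G.Edge u v
  restrict Trans.[ inj₁ _ , _ , () ]
  restrict Trans.[ inj₂ e , refl , refl ]   = Trans.[ e , refl , refl ]
  restrict ((inj₁ _ , _ , refl) ∷ p)        = contradiction p no-walk-from-new
  restrict ((inj₂ e , refl , refl) ∷ p)     = (e , refl , refl) ∷ restrict p

  acyclic : G.Acyclic → Acyclic
  acyclic ac nothing  = no-walk-from-new
  acyclic ac (just v) = ac v ∘ restrict

  append : ∀ {u} → Fin d → G.Path u σ → Path (just u) nothing
  append i ε                      = (inj₁ i , refl , refl) ◅ ε
  append i ((e , refl , refl) ◅ p) = (inj₂ e , refl , refl) ◅ append i p

  split : ∀ {u} → Path (just u) nothing → Fin d × G.Path u σ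
  split ((inj₁ i , refl , refl) ◅ _) = i , ε
  split ((inj₂ e , refl , refl) ◅ p) = map₂ ((e , refl , refl) ◅_) (split p)

  split-append : ∀ {u} i (p : G.Path u σ) → split (append i p) ≡ (i , p)
  split-append i ε                       = refl
  split-append i ((e , refl , refl) ◅ p) = cong (map₂ ((e , refl , refl) ◅_)) (split-append i p)

  append-split : ∀ {u} (p : Path (just u) nothing) → append (proj₁ (split p)) (proj₂ (split p)) ≡ p
  append-split ((inj₁ i , refl , refl) ◅ ε)       = refl
  append-split ((inj₁ i , refl , refl) ◅ (e ◅ _)) = contradiction e no-edge-from-new
  append-split ((inj₂ e , refl , refl) ◅ p)       = cong (_ ◅_) (append-split p)

  -- A nontrivial path to the new sink ends with one of the `d` new edges; removing it leaves a path
  -- to `σ`.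
  paths : (⊤ ⊎ Fin d × G.PathsEndingAt σ) ↔ PathsEndingAt nothing
  paths = mk↔ₛ′ to from to-from from-to
    where
    to : ⊤ ⊎ Fin d × G.PathsEndingAt σ → PathsEndingAt nothing
    to (inj₁ _)           = nothing , ε
    to (inj₂ (i , u , p)) = just u , append i p
    from : PathsEndingAt nothing → ⊤ ⊎ Fin d × G.PathsEndingAt σ
    from (nothing , _) = inj₁ tt
    from (just u , p)  = inj₂ (proj₁ (split p) , u , proj₂ (split p))
    to-from : ∀ p → to (from p) ≡ p
    to-from (nothing , ε)     = refl
    to-from (nothing , e ◅ _) = contradiction e no-edge-from-new
    to-from (just u , p)      = cong (just u ,_) (append-split p)
    from-to : ∀ p → from (to p) ≡ p
    from-to (inj₁ _)           = refl
    from-to (inj₂ (i , u , p)) = cong (λ (j , q) → inj₂ (j , u , q)) (split-append i p)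

-- At least one new edge is needed, both to keep the graph connected and to stop `σ` from being a
-- sink; hence `suc d`.
attach-sink : ∀ {N n} d → Attains N n → Attains (suc d + N) (1 + suc d * n)
attach-sink {N} d (G , A , count) = attached , admissible ,
  ((+↔⊎ ⟫ (1↔⊤ ⊎-↔ (*↔× ⟫ (↔-id _ ×-↔ count)))) ⟫ paths)
  where
  infixl 5 _⟫_
  _⟫_ : ∀ {X Y Z : Set} → X ↔ Y → Y ↔ Z → X ↔ Z
  _⟫_ = ↔-trans
  open Admissible A using (edges; connected; uniqueSink)
  σ = proj₁ uniqueSink
  open AttachSink G σ (suc d)
  open Digraph attached
  to-new : ∀ u → EqClosure Edge u nothing
  to-new nothing  = ε
  to-new (just u) = Eq.gmap just lift-edge (connected u σ) ◅◅ fwd (inj₁ fzero , refl , refl) ◅ ε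
  sink-is-new : ∀ {v} → IsSink v → nothing ≡ v
  sink-is-new {nothing} _    = refl
  sink-is-new {just u}  sink = contradiction
    (cong just (proj₂ (proj₂ uniqueSink) (λ e eq → sink (inj₂ e) (cong just eq))))
    (sink (inj₁ fzero))
  admissible : Admissible (suc d + N) attached
  admissible = record
    { edges      = +↔⊎ ⟫ (↔-id _ ⊎-↔ edges)
    ; connected  = λ u v → to-new u ◅◅ Eq.symmetric Edge (to-new v)
    ; acyclic    = acyclic (Admissible.acyclic A)
    ; uniqueSink = nothing , (λ { (inj₁ _) () ; (inj₂ _) () }) , sink-is-new
    }

-- The number of parallel edges, one more than the first argument of `attach-sink`, is chosen to
-- make `gain-superlinear` an equality.
attain : ∀ n → Attains n (suc (gain n))
attain 0 = point-attains
attain 1 = attach-sink 0 (attain 0)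
attain 2 = attach-sink 1 (attain 0)
attain 3 = attach-sink 1 (attain 1)
attain 4 = attach-sink 1 (attain 2)
attain 5 = attach-sink 1 (attain 3)
attain 6 = attach-sink 2 (attain 3)
attain 7 = attach-sink 1 (attain 5)
attain (suc (suc (suc n@(suc (suc (suc (suc (suc _)))))))) = attach-sink 2 (attain n)

-- Counting by covering lists.

Cover : {A : Set} → (A → Set) → ℕ → Set
Cover {A} P k = Σ[ xs ∈ List A ] (length xs ≤ k × (∀ {x} → P x → x ∈ xs))

module _ {A : Set} {P Q : A → Set} where

  cover-⊆ : ∀ {j k} → (∀ {x} → Q x → P x) → j ≤ k → Cover P j → Cover Q k
  cover-⊆ Q⊆P j≤k (xs , len , cov) = xs , ≤-trans len j≤k , cov ∘ Q⊆P

  cover-∪ : ∀ {j k} → Cover P j → Cover Q k → Cover (λ x → P x ⊎ Q x) (j + k)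
  cover-∪ (xs , len , cov) (ys , len′ , cov′) = xs ++ ys
    , subst (_≤ _) (sym (length-++ xs)) (+-mono-≤ len len′)
    , λ { (inj₁ p) → ∈-++⁺ˡ (cov p) ; (inj₂ q) → ∈-++⁺ʳ xs (cov′ q) }

-- Pigeonhole: distinct elements occupy distinct positions of the list.
cover⇒HasAtMost : ∀ {A : Set} {k} → Cover {A} (λ _ → ⊤) k → HasAtMost k A
cover⇒HasAtMost (xs , len , cov) m f =
  ≤-trans (injective⇒≤ {f = λ i → Any.index (position i)} index-injective) len
  where
  open Injection f using (to; injective)
  position : ∀ i → to i ∈ xs
  position i = cov tt
  index-injective : ∀ {i j} → Any.index (position i) ≡ Any.index (position j) → i ≡ j
  index-injective {i} {j} eq = injective (trans (lookup-index (position i))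
    (trans (cong (lookup xs) eq) (sym (lookup-index (position j)))))

length-filter-¬filter : ∀ {A : Set} {P : A → Set} (P? : ∀ x → Dec (P x)) xs →
  length (filter P? xs) + length (filter (¬? ∘ P?) xs) ≡ length xs
length-filter-¬filter P? []       = refl
length-filter-¬filter P? (x ∷ xs) with P? x
... | yes _ = cong suc (length-filter-¬filter P? xs)
... | no  _ = trans (+-suc _ _) (cong suc (length-filter-¬filter P? xs))

-- Upper bound: peeling off vertices.

module Peeling (G : Digraph) (_≟_ : DecidableEquality (Digraph.E⁰ G))
  (wellFounded : WellFounded (flip (Digraph.Edge G)))
  (σ : Digraph.E⁰ G) (sink : Digraph.IsSink G σ) where
  open Digraph G

  From : E⁰ → PathsEndingAt σ → Set
  From w (u , _) = u ≡ w

  First : List E¹ → PathsEndingAt σ → Set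
  First L (_ , ε)           = ⊥
  First L (_ , (e , _) ◅ _) = e ∈ L

  -- Only meaningful on paths from t e; other paths are returned unchanged.
  prepend : E¹ → PathsEndingAt σ → PathsEndingAt σ
  prepend e (u , p) with t e ≟ u
  ... | yes te≡u = s e , (e , refl , te≡u) ◅ p
  ... | no  _    = u , p

  prepend-target : ∀ e p → prepend e (t e , p) ≡ (s e , (e , refl , refl) ◅ p)
  prepend-target e p with t e ≟ t e | ≡-≟-identity _≟_ {t e} refl
  ... | .(yes refl) | refl = refl

  cover-first : ∀ L {B} → (∀ {e} → e ∈ L → Cover (From (t e)) B) →
                Cover (First L) (length L * B)
  cover-first []      _       = [] , z≤n , λ { {_ , ε} () ; {_ , _ ◅ _} () }
  cover-first (e ∷ L) targets = cover-⊆ head-or-tail ≤-refl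
    (cover-∪ via-e (cover-first L (targets ∘ there)))
    where
    via-e : Cover (First [ e ]) _
    via-e with (xs , len , cov) ← targets (here refl) = map (prepend e) xs
      , subst (_≤ _) (sym (length-map (prepend e) xs)) len
      , λ { {_ , (_ , refl , refl) ◅ p} (here refl) →
              subst (_∈ _) (prepend-target e p) (∈-map⁺ (prepend e) (cov refl)) }
    head-or-tail : ∀ {x} → First (e ∷ L) x → First [ e ] x ⊎ First L x
    head-or-tail {_ , _ ◅ _} (here eq)  = inj₁ (here eq)
    head-or-tail {_ , _ ◅ _} (there e∈) = inj₂ e∈

  Leaf : List E¹ → E⁰ → Set
  Leaf R v = ∀ {e} → e ∈ R → s e ≡ v → ∀ {e′} → e′ ∈ R → s e′ ≢ t e

  -- Keep moving along edges of `R` to vertices that still emit edges of `R`; well-foundedness makes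
  -- this stop.
  find-leaf : ∀ R v → Acc (flip Edge) v → Any (λ e → s e ≡ v) R →
              ∃[ w ] (Any (λ e → s e ≡ w) R × Leaf R w)
  find-leaf R v (acc rs) v-emits
    with any? (λ e → (s e ≟ v) ×-dec any? (λ e′ → s e′ ≟ t e) R) R
  ... | yes nonleaf with (e , _ , se≡v , te-emits) ← find nonleaf =
          find-leaf R (t e) (rs (e , se≡v , refl)) te-emits
  ... | no ¬nonleaf = v , v-emits ,
          λ e∈R se≡v e′∈R se′≡te → ¬nonleaf (lose e∈R (se≡v , lose e′∈R se′≡te))

  -- The peeling invariant: a vertex is settled or untouched. Nothing in between is needed, since a
  -- peeled vertex loses all its edges at once.
  Status : ℕ → List E¹ → E⁰ → Set
  Status B R w = Cover (From w) B ⊎ (w ≢ σ × (∀ {e} → s e ≡ w → e ∈ R))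

  -- Induction on a bound `n` for the number of edges left. Peeling a leaf with `d` edges in `R`
  -- adds at most `d * B` paths and raises the common bound to `d * B`; `gain-superlinear` absorbs
  -- this together with the bound for the remaining edges.
  cover-remaining : ∀ n R {B} → length R ≤ n → (∀ w → Status B R w) →
                    Cover (First R) (B * gain (length R))
  cover-remaining _ [] _ _ = cover-⊆ id z≤n (cover-first [] {0} λ ())
  cover-remaining (suc n) R@(e₀ ∷ _) {B} len status
    with (v , v-emits , leaf) ← find-leaf R (s e₀) (wellFounded _) (here refl) =
    cover-⊆ split size (cover-∪ cover-D (cover-remaining n R′ len′ status′))
    where
    from-v? : ∀ e → Dec (s e ≡ v)
    from-v? e = s e ≟ v
    D = filter from-v? R
    R′ = filter (¬? ∘ from-v?) R
    d = length D
    d+r′ : d + length R′ ≡ length R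
    d+r′ = length-filter-¬filter from-v? R
    d≥1 : 1 ≤ d
    d≥1 = filter-some from-v? v-emits
    len′ : length R′ ≤ n
    len′ = ≤-pred (≤-trans (+-monoˡ-≤ _ d≥1) (subst (_≤ suc n) (sym d+r′) len))
    B≤dB : B ≤ d * B
    B≤dB = m≤n*m B d {{>-nonZero d≥1}}

    cover-target : ∀ {e} → e ∈ D → Cover (From (t e)) B
    cover-target {e} e∈D with (e∈R , se≡v) ← ∈-filter⁻ from-v? {xs = R} e∈D | status (t e)
    ... | inj₁ c             = c
    -- All edges of this target lie in `R`, yet by the leaf property none of `R` starts there. So it
    -- emits no edge and, not being `σ`, starts no path to `σ`: the empty list covers.
    ... | inj₂ (te≢σ , outs) = [] , z≤n , λ
      { {_ , ε} σ≡te → contradiction (sym σ≡te) te≢σ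
      ; {_ , (_ , p , _) ◅ _} u≡te →
          contradiction (trans p u≡te) (leaf e∈R se≡v (outs (trans p u≡te))) }

    cover-D : Cover (First D) (d * B)
    cover-D = cover-first D cover-target

    status′ : ∀ w → Status (d * B) R′ w
    status′ w with status w
    ... | inj₁ c = inj₁ (cover-⊆ id B≤dB c)
    ... | inj₂ (w≢σ , outs) with w ≟ v
    ...   | no w≢v   = inj₂ (w≢σ , λ se≡w → ∈-filter⁺ (¬? ∘ from-v?) (outs se≡w)
                         λ se≡v → w≢v (trans (sym se≡w) se≡v))
    -- The peeled vertex becomes settled: all its edges are in `D`, so every path from it is already
    -- counted in `cover-D`.
    ...   | yes refl = inj₁ (cover-⊆ starts-in-D ≤-refl cover-D)
      where
      starts-in-D : ∀ {x} → From v x → First D x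
      starts-in-D {_ , ε} σ≡v                 = w≢σ (sym σ≡v)
      starts-in-D {_ , (_ , p , _) ◅ _} u≡v = ∈-filter⁺ from-v? (outs (trans p u≡v)) (trans p u≡v)

    split : ∀ {x} → First R x → First D x ⊎ First R′ x
    split {_ , (e , _) ◅ _} e∈R with from-v? e
    ... | yes se≡v = inj₁ (∈-filter⁺ from-v? e∈R se≡v)
    ... | no  se≢v = inj₂ (∈-filter⁺ (¬? ∘ from-v?) e∈R se≢v)

    size : d * B + d * B * gain (length R′) ≤ B * gain (length R)
    size = begin
      d * B + d * B * gain (length R′)    ≡⟨ lem d B (gain (length R′)) ⟩
      B * (d * suc (gain (length R′)))    ≤⟨ *-monoʳ-≤ B (gain-superlinear d (length R′)) ⟩
      B * gain (d + length R′)            ≡⟨ cong (λ r → B * gain r) d+r′ ⟩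
      B * gain (length R)                 ∎
      where
      open ≤-Reasoning
      lem : ∀ d B g → d * B + d * B * g ≡ B * (d * suc g)
      lem = solve-∀

  -- At first only `σ` is settled, by its trivial path, so peeling starts with bound 1; that trivial
  -- path is also the extra 1 in the total.
  cover-all : ∀ es → (∀ e → e ∈ es) → Cover {PathsEndingAt σ} (λ _ → ⊤) (suc (gain (length es)))
  cover-all es complete = cover-⊆ trivial-or-first (≤-reflexive (cong suc (*-identityˡ _)))
    (cover-∪ cover-σ (cover-remaining (length es) es ≤-refl status))
    where
    cover-σ : Cover (From σ) 1
    cover-σ = [ σ , ε ] , ≤-refl , λ
      { {_ , ε} _ → here refl
      ; {_ , (e , p , _) ◅ _} u≡σ → contradiction (trans p u≡σ) (sink e) }
    status : ∀ w → Status 1 es w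
    status w with w ≟ σ
    ... | yes refl = inj₁ cover-σ
    ... | no  w≢σ  = inj₂ (w≢σ , λ _ → complete _)
    trivial-or-first : ∀ {x} → ⊤ → From σ x ⊎ First es x
    trivial-or-first {_ , ε} _           = inj₁ refl
    trivial-or-first {_ , (e , _) ◅ _} _ = inj₂ (complete e)

-- Admissible graphs satisfy the peeling hypotheses.

module _ {N : ℕ} {G : Digraph} (A : Admissible N G) where
  open Digraph G
  open Admissible A

  private
    σ = proj₁ uniqueSink
    edge = Inverse.to edges
    number = Inverse.from edges

    edge-number : ∀ e → edge (number e) ≡ e
    edge-number = Inverse.strictlyInverseˡ edges

  -- The edges are the numbered objects, so the order is put on them: by acyclicity, nonempty walks
  -- between sources give a strict partial order on `Fin N`, well-founded by finiteness.
  -- Accessibility then passes to targets of edges.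
  successor-wellFounded : WellFounded (flip Edge)
  successor-wellFounded u = acc λ { (e , _ , refl) → accessible e }
    where
    Later : Fin N → Fin N → Set
    Later j i = TransClosure Edge (s (edge i)) (s (edge j))
    later-wellFounded : WellFounded Later
    later-wellFounded = spo-wellFounded record
      { isEquivalence = isEquivalence
      ; irrefl        = λ { refl → acyclic _ }
      ; trans         = λ p q → q Trans.++ p
      ; <-resp-≈      = resp₂ Later
      }
    target-accessible : ∀ i → Acc Later i → Acc (flip Edge) (t (edge i))
    target-accessible i (acc rs) = acc λ
      { (e , se≡t , refl) → subst (Acc _ ∘ t) (edge-number e)
          (target-accessible (number e)
            (rs Trans.[ edge i , refl , trans (sym se≡t) (cong s (sym (edge-number e))) ])) }
    accessible : ∀ e → Acc (flip Edge) (t e)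
    accessible e = subst (Acc _ ∘ t) (edge-number e)
      (target-accessible (number e) (later-wellFounded (number e)))

  edgeList : List E¹
  edgeList = map edge (allFin N)

  edgeList-complete : ∀ e → e ∈ edgeList
  edgeList-complete e = subst (_∈ edgeList) (edge-number e) (∈-map⁺ edge (∈-allFin (number e)))

  length-edgeList : length edgeList ≡ N
  length-edgeList = trans (length-map edge (allFin N)) (length-tabulate id)

  vertexList : List E⁰
  vertexList = σ ∷ map s edgeList ++ map t edgeList

  -- By connectedness, a vertex other than `σ` is an endpoint of the first edge of an undirected
  -- path to `σ`.
  vertexList-complete : ∀ v → v ∈ vertexList
  vertexList-complete v with connected v σ
  ... | ε = here refl
  ... | fwd (e , refl , _) ◅ _ = there (∈-++⁺ˡ (∈-map⁺ s (edgeList-complete e)))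
  ... | bwd (e , _ , refl) ◅ _ = there (∈-++⁺ʳ _ (∈-map⁺ t (edgeList-complete e)))

  -- Excluded middle holds under double negation for each pair of vertices, and double negation
  -- commutes with conjunction over the finite list of pairs.
  ¬¬-decidable-vertices : ¬ ¬ DecidableEquality E⁰
  ¬¬-decidable-vertices = ¬¬-map
    (λ all u v → All.lookup all (∈-cartesianProduct⁺ (vertexList-complete u) (vertexList-complete v)))
    (All.sequenceM _ ¬¬-Monad
      (All.universal (λ (u , v) → ¬¬-excluded-middle {A = u ≡ v})
        (cartesianProduct vertexList vertexList)))

  -- The bound is a stable proposition, so vertex equality may be assumed decidable.
  atMost : HasAtMost (suc (gain N)) PathsToSink
  atMost m f = decidable-stable (m ≤? _) (¬¬-map bound ¬¬-decidable-vertices)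
    where
    bound : DecidableEquality E⁰ → m ≤ suc (gain N)
    bound _≟_ = cover⇒HasAtMost
      (subst (Cover _ ∘ suc ∘ gain) length-edgeList (cover-all edgeList edgeList-complete)) m f
      where open Peeling G _≟_ successor-wellFounded σ (proj₁ (proj₂ uniqueSink))

theorem4p12 : (N k : ℕ) (i : Fin 3) → 5 ≤ N → N ≡ 3 * k + toℕ i →
    IsSP N (closedForm k i)
theorem4p12 N k i 5≤N refl = subst (IsSP N) (sym (closedForm-gain k i 5≤N)) record
  { attained   = attain N
  ; upperBound = λ _ A → atMost A
  }
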